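{- (Epistemic mutual exclusion.) In the model of Peterson's two-thread algorithm described in the context, the global invariant $\mathbf{Always}\,\neg(\mathsf{InCS}_0\wedge\mathsf{InCS}_1)$ (valid at every point of the model) yields, since $\mathsf{InCS}_i$ is determined by thread $i$'s local control state, that for each thread $i\in\{0,1\}$ and $j=1-i$ the formula $$\mathbf{Always}\bigl(\mathsf{InCS}_i\rightarrow\mathbf{K}_i\,\neg\mathsf{InCS}_j\bigr)$$ holds at every point of the model.
   Context: **Program.** Threads are $0$ and $1$; for a thread $i$ write $j=1-i$. Shared variables: $\mathtt{flag}[0],\mathtt{flag}[1]\in\{0,1\}$ and $\mathtt{victim}\in\{0,1\}$. Thread $i$ executes, in program order: `flag[i]=1; victim=i; while (flag[j]==1 && victim==i) {spin}; critical section; flag[i]=0`. Its control locations are $\ell^{\mathsf{flag}}$ (about to execute `flag[i]=1`), $\ell^{\mathsf{victim}}$ (about to execute `victim=i`), $\ell^{\mathsf{waitF}},\ell^{\mathsf{waitV}}$ (spin loop), $\ell^{\mathsf{cs}}$ (critical section), $\ell^{\mathsf{exit}}$ (about to execute `flag[i]=0`); a terminated thread is accommodated by stuttering (a self-loop at a final location). The loop guard is split into read micro-steps with one shared access each: from $\ell^{\mathsf{waitF}}$ a step reads $\mathtt{flag}[j]$ and enters $\ell^{\mathsf{cs}}$ if it reads $0$, otherwise it moves to $\ell^{\mathsf{waitV}}$; from $\ell^{\mathsf{waitV}}$ a step reads $\mathtt{victim}$ and enters $\ell^{\mathsf{cs}}$ iff $\mathtt{victim}\neq i$, else it goes back to $\ell^{\mathsf{waitF}}$.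 Thus, by control flow: thread $i$ executes `flag[i]=1` before reaching $\ell^{\mathsf{cs}}$, and executes `flag[i]=0` only after leaving the critical section; `victim=i` is preceded by `flag[i]=1` and executed immediately before entering the spin loop; thread $i$'s other steps do not write $\mathtt{flag}[i]$; the spin loop writes neither $\mathtt{flag}[i]$ nor $\mathtt{victim}$. **Runs.** A global state $s$ consists of the shared store and, for each thread $i$, a local component $s.\lambda_i$ (control location and local variables, including registers recording the last value read from each shared variable that $i$ reads). A run is an infinite sequence $\pi=s_0s_1\cdots$ of global states in which each step $s_t\to s_{t+1}$ is a step of exactly one thread $\mathsf{act}(t)$; a step of one thread leaves the other thread's local component unchanged. Points are pairs $(\pi,t)$, $t\ge0$. **Formulas.** State predicates are evaluated in $s_t$; $\mathsf{at}(i,\ell)$ says that thread $i$ is at location $\ell$, and $\mathsf{InCS}_i:=\mathsf{at}(i,\ell^{\mathsf{cs}})$. $(\pi,t)\models\mathbf{Prev}\,\phi$ iff $t>0$ and $(\pi,t-1)\models\phi$. $(\pi,t)\models\mathbf{Always}\,\phi$ iff $(\pi,k)\models\phi$ for all $0\le k\le t$. $\mathsf{after}_i$ holds at $(\pi,t)$ iff $t>0$ and $\mathsf{act}(t-1)=i$. $x=\mathbf{Prev}\,x$ holds at $(\pi,t)$ iff $t=0$ or $x$ has the same value in $s_{t-1}$ and $s_t$. Events: $\mathsf{SetFlag}_i:=\mathsf{after}_i\wedge\mathbf{Prev}\,\mathsf{at}(i,\ell^{\mathsf{flag}})$, $\mathsf{SetVictim}_i:=\mathsf{after}_i\wedge\mathbf{Prev}\,\mathsf{at}(i,\ell^{\mathsf{victim}})$,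 $\mathsf{ClearFlag}_i:=\mathsf{after}_i\wedge\mathbf{Prev}\,\mathsf{at}(i,\ell^{\mathsf{exit}})$. **Model constraints.** The model consists of the runs at all points of which the following hold, for $i\in\{0,1\}$: $\mathbf{Always}(\neg\mathsf{after}_i\rightarrow \mathtt{flag}[i]=\mathbf{Prev}\,\mathtt{flag}[i])$; $\mathbf{Always}(\mathsf{SetFlag}_i\rightarrow\mathtt{flag}[i]=1)$; $\mathbf{Always}(\mathsf{ClearFlag}_i\rightarrow\mathtt{flag}[i]=0)$; $\mathbf{Always}(\mathsf{SetVictim}_i\rightarrow\mathtt{victim}=i)$; $\mathbf{Always}\bigl(\neg(\mathsf{SetVictim}_0\vee\mathsf{SetVictim}_1)\rightarrow\mathtt{victim}=\mathbf{Prev}\,\mathtt{victim}\bigr)$. **Knowledge.** $\mathsf{obs}_i(s)=s.\lambda_i$. If $k_1<\cdots<k_m$ are the indices $k<t$ with $\mathsf{act}(k)=i$, then $\mathsf{Hist}_i(\pi,t)=\langle\mathsf{obs}_i(s_0),\mathsf{obs}_i(s_{k_1+1}),\dots,\mathsf{obs}_i(s_{k_m+1}),\mathsf{obs}_i(s_t)\rangle$. $(\pi,t)\models\mathbf{K}_i\phi$ iff $(\pi',t')\models\phi$ for all points $(\pi',t')$ of the model with $\mathsf{Hist}_i(\pi',t')=\mathsf{Hist}_i(\pi,t)$. -}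

module Defs where

open import Data.Empty using (⊥)
open import Data.Fin using (Fin)
open import Data.Fin.Patterns using (0F; 1F)
open import Data.Fin.Properties using (_≟_)
open import Data.List using (List; _∷_; _∷ʳ_; filter; map; upTo)
open import Data.Maybe using (Maybe; just; nothing)
open import Data.Nat using (ℕ; zero; suc; _≤_)
open import Data.Product using (_×_; _,_)
open import Data.Unit using (⊤)
open import Data.Vec using (Vec; lookup; _[_]≔_)
open import Level using (0ℓ)
open import Relation.Binary.PropositionalEquality using (_≡_)
open import Relation.Nullary using (yes; no)
open import Relation.Unary using (Pred; ∁; _∩_; _∪_; _⇒_)

Thread : Set
Thread = Fin 2

other : Thread → Thread
other 0F = 1F
other 1F = 0F

data Location : Set where
  ℓflag ℓvictim ℓwaitF ℓwaitV ℓcs ℓexit ℓfinal : Location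

record Store : Set where
  constructor mkStore
  field
    flag   : Vec (Fin 2) 2
    victim : Thread

-- The registers of thread i hold the last values it read from flag[other i]
-- and from victim (nothing before the first such read).
record Local : Set where
  constructor mkLocal
  field
    loc       : Location
    flagReg   : Maybe (Fin 2)
    victimReg : Maybe Thread

record State : Set where
  constructor mkState
  field
    store  : Store
    locals : Vec Local 2

open Store public
open Local public
open State public

flagOf : Thread → State → Fin 2
flagOf i s = lookup (flag (store s)) i

victimOf : State → Thread
victimOf s = victim (store s)

localOf : Thread → State → Local
localOf i s = lookup (locals s) i

afterReadFlag : Fin 2 → Location
afterReadFlag 0F = ℓcs
afterReadFlag 1F = ℓwaitV

afterReadVictim : Thread → Thread → Location
afterReadVictim i v with v ≟ i
... | yes _ = ℓwaitF
... | no  _ = ℓcs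

-- One step of thread i, as a transformation of the store and of i's local
-- component.  Every thread has exactly one enabled step in every state; the
-- step at ℓfinal is the stuttering self-loop.
exec : Thread → Store → Local → Store × Local
exec i σ (mkLocal ℓflag   f v) =
  mkStore (flag σ [ i ]≔ 1F) (victim σ) , mkLocal ℓvictim f v
exec i σ (mkLocal ℓvictim f v) =
  mkStore (flag σ) i , mkLocal ℓwaitF f v
exec i σ (mkLocal ℓwaitF  f v) =
  σ , mkLocal (afterReadFlag x) (just x) v
  where x = lookup (flag σ) (other i)
exec i σ (mkLocal ℓwaitV  f v) =
  σ , mkLocal (afterReadVictim i (victim σ)) f (just (victim σ))
exec i σ (mkLocal ℓcs     f v) =
  σ , mkLocal ℓexit f v
exec i σ (mkLocal ℓexit   f v) =
  mkStore (flag σ [ i ]≔ 0F) (victim σ) , mkLocal ℓfinal f v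
exec i σ (mkLocal ℓfinal  f v) =
  σ , mkLocal ℓfinal f v

record Step (i : Thread) (s s′ : State) : Set where
  field
    acts  : (store s′ , localOf i s′) ≡ exec i (store s) (localOf i s)
    frame : localOf (other i) s′ ≡ localOf (other i) s

-- The initial store is left arbitrary.
record Run : Set where
  field
    state : ℕ → State
    act   : ℕ → Thread
    init  : ∀ i → localOf i (state 0) ≡ mkLocal ℓflag nothing nothing
    steps : ∀ t → Step (act t) (state t) (state (suc t))

open Run public

Point : Set
Point = Run × ℕ

-- Formulas are embedded as predicates on points, with the Boolean connectives
-- ¬, ∧, ∨, → given by ∁, _∩_, _∪_, _⇒_.
Formula : Set₁
Formula = Pred Point 0ℓ

at : Thread → Location → Formula
at i ℓ (π , t) = loc (localOf i (state π t)) ≡ ℓ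

InCS : Thread → Formula
InCS i = at i ℓcs

Prev : Formula → Formula
Prev φ (π , zero)  = ⊥
Prev φ (π , suc t) = φ (π , t)

Always : Formula → Formula
Always φ (π , t) = ∀ k → k ≤ t → φ (π , k)

after : Thread → Formula
after i (π , zero)  = ⊥
after i (π , suc t) = act π t ≡ i

_has-value_ : {A : Set} → (State → A) → A → Formula
(x has-value a) (π , t) = x (state π t) ≡ a

-- The formula x = Prev x.
Unchanged : {A : Set} → (State → A) → Formula
Unchanged x (π , zero)  = ⊤
Unchanged x (π , suc t) = x (state π t) ≡ x (state π (suc t))

SetFlag SetVictim ClearFlag : Thread → Formula
SetFlag   i = after i ∩ Prev (at i ℓflag)
SetVictim i = after i ∩ Prev (at i ℓvictim)
ClearFlag i = after i ∩ Prev (at i ℓexit)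

-- The store updates in exec already imply these constraints; they are kept
-- because the model is defined as the set of runs satisfying them.
record Constraints (p : Point) : Set where
  field
    flag-local   : ∀ i → Always (∁ (after i) ⇒ Unchanged (flagOf i)) p
    flag-set     : ∀ i → Always (SetFlag i ⇒ flagOf i has-value 1F) p
    flag-cleared : ∀ i → Always (ClearFlag i ⇒ flagOf i has-value 0F) p
    victim-set   : ∀ i → Always (SetVictim i ⇒ victimOf has-value i) p
    victim-kept  : Always (∁ (SetVictim 0F ∪ SetVictim 1F) ⇒ Unchanged victimOf) p

InModel : Pred Run 0ℓ
InModel π = ∀ t → Constraints (π , t)

Valid : Formula → Set
Valid φ = ∀ π → InModel π → ∀ t → φ (π , t)

obs : Thread → State → Local
obs = localOf

Hist : Thread → Point → List Local
Hist i (π , t) =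
  (obs i (state π 0) ∷
   map (λ k → obs i (state π (suc k))) (filter (λ k → act π k ≟ i) (upTo t)))
  ∷ʳ obs i (state π t)

K : Thread → Formula → Formula
K i φ p = ∀ π′ → InModel π′ → ∀ t′ → Hist i (π′ , t′) ≡ Hist i p → φ (π′ , t′)

{-# OPTIONS --safe #-}

-- Peterson's algorithm keeps the invariant that a thread between its flag
-- writes has its flag up, and that while one thread is in (or just leaving) the
-- critical section, the other is outside the protocol, has not yet written
-- victim, or spins with victim equal to itself.  The invariant excludes both
-- threads being in the critical section.  As the last entry of a history is the
-- current local component, indistinguishable points agree on InCS, so exclusion
-- at all points of the model is known by the thread inside.
module Submission where

open import Data.Empty using (⊥; ⊥-elim)
open import Data.Fin.Patterns using (0F; 1F)
open import Data.Fin.Properties using (_≟_)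
open import Data.List using (List; _∷_; filter; map; upTo)
open import Data.List.Properties using (∷ʳ-injectiveʳ)
open import Data.Nat using (zero; suc)
open import Data.Product using (_×_; _,_; proj₁; proj₂)
open import Data.Unit using (⊤; tt)
open import Data.Vec using (lookup)
open import Data.Vec.Properties using (lookup∘update; lookup∘update′)
open import Function using (_∘_)
open import Relation.Binary.PropositionalEquality
  using (_≡_; _≢_; refl; sym; trans; cong; subst₂)
open import Relation.Nullary using (¬_; yes; no)
open import Relation.Unary using (∁; _∩_; _⇒_)
open import Defs

other≢ : ∀ i → other i ≢ i
other≢ 0F ()
other≢ 1F ()

≢⇒≡other : ∀ i {v} → v ≢ i → v ≡ other i
≢⇒≡other 0F {0F} v≢i = ⊥-elim (v≢i refl)
≢⇒≡other 0F {1F} _   = refl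
≢⇒≡other 1F {0F} _   = refl
≢⇒≡other 1F {1F} v≢i = ⊥-elim (v≢i refl)

Claims : Location → Set
Claims ℓflag  = ⊥
Claims ℓfinal = ⊥
Claims _      = ⊤

Inside : Location → Set
Inside ℓcs   = ⊤
Inside ℓexit = ⊤
Inside _     = ⊥

-- The condition on thread i, located at ℓ, while the other thread is inside
-- and victim has the value v.
Yields : Thread → Location → Thread → Set
Yields i ℓflag   v = ⊤
Yields i ℓvictim v = ⊤
Yields i ℓwaitF  v = v ≡ i
Yields i ℓwaitV  v = v ≡ i
Yields i ℓcs     v = ⊥
Yields i ℓexit   v = ⊥
Yields i ℓfinal  v = ⊤

inside⇒claims : ∀ ℓ → Inside ℓ → Claims ℓ
inside⇒claims ℓcs   _ = tt
inside⇒claims ℓexit _ = tt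

¬claims⇒yields : ∀ i ℓ {v} → ¬ Claims ℓ → Yields i ℓ v
¬claims⇒yields i ℓflag   _  = tt
¬claims⇒yields i ℓvictim _  = tt
¬claims⇒yields i ℓwaitF  ¬c = ⊥-elim (¬c tt)
¬claims⇒yields i ℓwaitV  ¬c = ⊥-elim (¬c tt)
¬claims⇒yields i ℓcs     ¬c = ¬c tt
¬claims⇒yields i ℓexit   ¬c = ¬c tt
¬claims⇒yields i ℓfinal  _  = tt

victim∧¬inside⇒yields : ∀ i ℓ {v} → v ≡ i → ¬ Inside ℓ → Yields i ℓ v
victim∧¬inside⇒yields i ℓflag   _   _  = tt
victim∧¬inside⇒yields i ℓvictim _   _  = tt
victim∧¬inside⇒yields i ℓwaitF  v≡i _  = v≡i
victim∧¬inside⇒yields i ℓwaitV  v≡i _  = v≡i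
victim∧¬inside⇒yields i ℓcs     _   ¬c = ¬c tt
victim∧¬inside⇒yields i ℓexit   _   ¬c = ¬c tt
victim∧¬inside⇒yields i ℓfinal  _   _  = tt

-- Thread i is at ℓ and the other thread at m.
record Inv (i : Thread) (σ : Store) (ℓ m : Location) : Set where
  constructor mkInv
  field
    raised       : Claims ℓ → lookup (flag σ) i ≡ 1F
    other-raised : Claims m → lookup (flag σ) (other i) ≡ 1F
    yields       : Inside m → Yields i ℓ (victim σ)
    other-yields : Inside ℓ → Yields (other i) m (victim σ)

-- Splitting on `i` lets `other (other i)` compute to `i`, so the fields merely change places.
inv-swap : ∀ i {σ ℓ m} → Inv i σ ℓ m → Inv (other i) σ m ℓ
inv-swap 0F (mkInv r r′ y y′) = mkInv r′ r y′ y
inv-swap 1F (mkInv r r′ y y′) = mkInv r′ r y′ y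

exec-inv : ∀ i σ l {m} → Inv i σ (loc l) m →
           Inv i (proj₁ (exec i σ l)) (loc (proj₂ (exec i σ l))) m
exec-inv i σ (mkLocal ℓflag _ _) (mkInv _ r′ _ _) = mkInv
  (λ _ → lookup∘update i (flag σ) 1F)
  (trans (lookup∘update′ (other≢ i) (flag σ) 1F) ∘ r′)
  (λ _ → tt)
  (λ ())
exec-inv i σ (mkLocal ℓvictim _ _) (mkInv r r′ _ _) =
  -- The new `victim` is `i`, just what `Yields` asks at `ℓwaitF`; `i` is not inside, so the other
  -- thread owes nothing.
  mkInv r r′ (λ _ → refl) (λ ())
exec-inv i σ (mkLocal ℓwaitF _ _) {m} inv
  with lookup (flag σ) (other i) in eq
-- Reading 0 contradicts `other-raised` if the other thread claims; so it does not, hence it is not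
-- inside and yields.
... | 0F = mkInv (Inv.raised inv) (Inv.other-raised inv)
                 (¬claims ∘ inside⇒claims m)
                 (λ _ → ¬claims⇒yields (other i) m ¬claims)
  where
  ¬claims : ¬ Claims m
  ¬claims c with () ← trans (sym eq) (Inv.other-raised inv c)
... | 1F = mkInv (Inv.raised inv) (Inv.other-raised inv)
                 (Inv.yields inv) (λ ())
exec-inv i σ (mkLocal ℓwaitV _ _) {m} (mkInv r r′ y y′) with victim σ ≟ i
... | yes _  = mkInv r r′ y y′
-- Were the other thread inside, `y` would force `victim σ ≡ i`. So it is outside, and being the
-- victim it yields.
... | no v≢i = mkInv r r′ (v≢i ∘ y)
                     (λ _ → victim∧¬inside⇒yields (other i) m
                              (≢⇒≡other i v≢i) (v≢i ∘ y))
exec-inv i σ (mkLocal ℓcs _ _) (mkInv r r′ y y′) = mkInv r r′ y y′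
exec-inv i σ (mkLocal ℓexit _ _) (mkInv _ r′ _ _) = mkInv
  (λ ())
  (trans (lookup∘update′ (other≢ i) (flag σ) 0F) ∘ r′)
  (λ _ → tt)
  (λ ())
exec-inv i σ (mkLocal ℓfinal _ _) inv = inv

-- Both views are kept, so that a step can start from that of the acting thread.
Invariant : State → Set
Invariant s =
  ∀ i → Inv i (store s) (loc (localOf i s)) (loc (localOf (other i) s))

invariant-from : ∀ i s →
  Inv i (store s) (loc (localOf i s)) (loc (localOf (other i) s)) → Invariant s
invariant-from 0F _ inv 0F = inv
invariant-from 0F _ inv 1F = inv-swap 0F inv
invariant-from 1F _ inv 0F = inv-swap 1F inv
invariant-from 1F _ inv 1F = inv

step-invariant : ∀ {i s s′} → Step i s s′ → Invariant s → Invariant s′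
step-invariant {i} {s} {s′} st inv = invariant-from i s′
  (subst₂ (λ (σ , l) l′ → Inv i σ (loc l) (loc l′))
    (sym (Step.acts st)) (sym (Step.frame st))
    (exec-inv i (store s) (localOf i s) (inv i)))

invariant : ∀ π t → Invariant (state π t)
invariant π zero i rewrite init π i | init π (other i) =
  -- `ℓflag` neither claims nor is inside: all four conditions are vacuous, whatever the initial
  -- store.
  mkInv (λ ()) (λ ()) (λ ()) (λ ())
invariant π (suc t) = step-invariant (steps π t) (invariant π t)

exclusion : ∀ i p → InCS i p → ∁ (InCS (other i)) p
exclusion i (π , t) cs cs′ = excludes cs cs′ (invariant π t i)
  where
  excludes : ∀ {σ ℓ m} → ℓ ≡ ℓcs → m ≡ ℓcs → ¬ Inv i σ ℓ m
  -- `Yields` at `ℓcs` is `⊥`, so `other-yields` is already the contradiction.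
  excludes refl refl inv = Inv.other-yields inv tt

moves : Thread → Point → List Local
moves i (π , t) =
  map (λ k → obs i (state π (suc k))) (filter (λ k → act π k ≟ i) (upTo t))

Hist≡⇒obs≡ : ∀ i π t π′ t′ → Hist i (π′ , t′) ≡ Hist i (π , t) →
             obs i (state π′ t′) ≡ obs i (state π t)
Hist≡⇒obs≡ i π t π′ t′ =
  ∷ʳ-injectiveʳ (obs i (state π′ 0) ∷ moves i (π′ , t′))
                (obs i (state π 0) ∷ moves i (π , t))

mainTheorem6 : Valid (Always (∁ (InCS 0F ∩ InCS 1F)))
    × (∀ i → Valid (Always (InCS i ⇒ K i (∁ (InCS (other i))))))
mainTheorem6 =
    (λ π _ _ k _ (cs₀ , cs₁) → exclusion 0F (π , k) cs₀ cs₁)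
  , (λ i π _ _ k _ cs π′ _ t′ same →
       exclusion i (π′ , t′) (trans (cong loc (Hist≡⇒obs≡ i π k π′ t′ same)) cs))
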